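{- Let $G$ be a connected graph with at least $3$ vertices. Then: (a) for any $\lambda\le-1$ there is a unique clustering maximizing $Q^\lambda$, and it has exactly one cluster, containing all vertices of $G$; and (b) for any $\lambda\ge1$ there is a unique clustering maximizing $Q^\lambda$, and it consists solely of clusters of size $1$.
   Context: A graph $G=(V,E)$ is finite and undirected, with $E$ a set of unordered pairs of distinct vertices. $\deg(v)$ is the degree of $v$; for $C\subseteq V$, $\mathrm{vol}(C)=\sum_{v\in C}\deg(v)$, and $E(C)$ is the set of edges with both endpoints in $C$. A clustering of $G$ is a partition of $V$ into some number of disjoint nonempty subsets (clusters) whose union is $V$. For a clustering $\mathcal{C}=\{C_1,\dots,C_k\}$ and $\lambda\in\mathbb{R}$, $Q^\lambda(\mathcal{C})=Q^\lambda_{\deg}(\mathcal{C})=\sum_{i=1}^k\left(\lambda+\frac{2|E(C_i)|}{\mathrm{vol}(C_i)}\right)$. The maximization is over all clusterings, with any number of clusters. -}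

module Defs where

open import Data.Fin.Base using (Fin)
import Data.Fin.Properties as Fin
open import Data.Fin.Subset using (Subset; _∈_; _∩_; ⋃; ⊤; Nonempty; Empty)
open import Data.Fin.Subset.Properties using (_∈?_)
open import Data.Integer.Base using (+_)
open import Data.List.Base
  using (List; allFin; cartesianProduct; filter; foldr; length; map)
open import Data.List.Relation.Binary.BagAndSetEquality using (_∼[_]_; set)
open import Data.List.Relation.Unary.All using (All)
open import Data.List.Relation.Unary.AllPairs using (AllPairs)
open import Data.Nat.Base as ℕ using (ℕ; zero; suc; _⊔_)
open import Data.Nat.ListAction using (sum)
import Data.Nat.Properties as ℕ
open import Data.Product.Base using (∃-syntax; _×_; _,_)
open import Data.Rational.Base as ℚ using (ℚ; 0ℚ; 1ℚ; ½; ∣_∣)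
import Data.Rational.Properties as ℚ
open import Data.Rational.Solver using (module +-*-Solver)
open import Level using (0ℓ)
open import Relation.Binary.Construct.Closure.ReflexiveTransitive using (Star)
open import Relation.Binary.Core using (Rel)
open import Relation.Binary.Definitions using (Decidable; Irreflexive; Symmetric)
open import Relation.Binary.PropositionalEquality
  using (_≡_; refl; sym; cong; subst)
open import Relation.Nullary.Decidable using (_×-dec_)

-- A real number is a Cauchy sequence of rationals. The quotient is not
-- formed: x and y denote the same real when x ≤ᵣ y and y ≤ᵣ x.

Cauchy : (ℕ → ℚ) → Set
Cauchy x = ∀ ε → 0ℚ ℚ.< ε →
  ∃[ N ] (∀ m n → N ℕ.≤ m → N ℕ.≤ n → ∣ x m ℚ.- x n ∣ ℚ.< ε)

record ℝ : Set where
  constructor mkℝ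
  field
    seq    : ℕ → ℚ
    cauchy : Cauchy seq

open ℝ public

infix  4 _≤ᵣ_
infixl 6 _+ᵣ_

_≤ᵣ_ : Rel ℝ 0ℓ
x ≤ᵣ y = ∀ ε → 0ℚ ℚ.< ε →
  ∃[ N ] (∀ n → N ℕ.≤ n → seq x n ℚ.≤ seq y n ℚ.+ ε)

fromℚ : ℚ → ℝ
fromℚ q = mkℝ (λ _ → q) λ ε 0<ε →
  0 , λ _ _ _ _ → subst (ℚ._< ε) (sym (cong ∣_∣ (ℚ.+-inverseʳ q))) 0<ε

private
  +-minus-interchange : ∀ a b c d →
    (a ℚ.+ b) ℚ.- (c ℚ.+ d) ≡ (a ℚ.- c) ℚ.+ (b ℚ.- d)
  +-minus-interchange = solve 4
    (λ a b c d → (a :+ b) :- (c :+ d) := (a :- c) :+ (b :- d)) refl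
    where open +-*-Solver

  half+half : ∀ ε → ½ ℚ.* ε ℚ.+ ½ ℚ.* ε ≡ ε
  half+half = solve 1 (λ ε → con ½ :* ε :+ con ½ :* ε := ε) refl
    where open +-*-Solver

  half-pos : ∀ ε → 0ℚ ℚ.< ε → 0ℚ ℚ.< ½ ℚ.* ε
  half-pos ε 0<ε =
    subst (ℚ._< ½ ℚ.* ε) (ℚ.*-zeroʳ ½) (ℚ.*-monoʳ-<-pos ½ 0<ε)

  +-cauchy : ∀ x y → Cauchy x → Cauchy y → Cauchy (λ n → x n ℚ.+ y n)
  +-cauchy x y cx cy ε 0<ε
    with cx (½ ℚ.* ε) (half-pos ε 0<ε) | cy (½ ℚ.* ε) (half-pos ε 0<ε)
  ... | N₁ , p | N₂ , q = N₁ ⊔ N₂ , λ m n N≤m N≤n → begin-strict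
    ∣ (x m ℚ.+ y m) ℚ.- (x n ℚ.+ y n) ∣
      ≡⟨ cong ∣_∣ (+-minus-interchange (x m) (y m) (x n) (y n)) ⟩
    ∣ (x m ℚ.- x n) ℚ.+ (y m ℚ.- y n) ∣
      ≤⟨ ℚ.∣p+q∣≤∣p∣+∣q∣ (x m ℚ.- x n) (y m ℚ.- y n) ⟩
    ∣ x m ℚ.- x n ∣ ℚ.+ ∣ y m ℚ.- y n ∣
      <⟨ ℚ.+-mono-<
           (p m n (ℕ.m⊔n≤o⇒m≤o N₁ N₂ N≤m) (ℕ.m⊔n≤o⇒m≤o N₁ N₂ N≤n))
           (q m n (ℕ.m⊔n≤o⇒n≤o N₁ N₂ N≤m) (ℕ.m⊔n≤o⇒n≤o N₁ N₂ N≤n)) ⟩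
    ½ ℚ.* ε ℚ.+ ½ ℚ.* ε
      ≡⟨ half+half ε ⟩
    ε ∎
    where open ℚ.≤-Reasoning

_+ᵣ_ : ℝ → ℝ → ℝ
x +ᵣ y = mkℝ (λ n → seq x n ℚ.+ seq y n)
  (+-cauchy (seq x) (seq y) (cauchy x) (cauchy y))

0ᵣ 1ᵣ -1ᵣ : ℝ
0ᵣ  = fromℚ 0ℚ
1ᵣ  = fromℚ 1ℚ
-1ᵣ = fromℚ (ℚ.- 1ℚ)

record Graph (n : ℕ) : Set₁ where
  infix 4 _~_ _~?_
  field
    _~_      : Rel (Fin n) 0ℓ
    _~?_     : Decidable _~_
    ~-sym    : Symmetric _~_
    ~-irrefl : Irreflexive _≡_ _~_

Connected : ∀ {n} → Graph n → Set
Connected G = ∀ u v → Star _~_ u v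
  where open Graph G

module _ {n : ℕ} (G : Graph n) where
  open Graph G

  deg : Fin n → ℕ
  deg v = length (filter (v ~?_) (allFin n))

  vol : Subset n → ℕ
  vol C = sum (map deg (filter (_∈? C) (allFin n)))

  -- The edge {u , v} is listed once, as the pair (u , v) with u < v.
  edges : List (Fin n × Fin n)
  edges = filter (λ (u , v) → (u Fin.<? v) ×-dec (u ~? v))
                 (cartesianProduct (allFin n) (allFin n))

  edgesWithin : Subset n → List (Fin n × Fin n)
  edgesWithin C = filter (λ (u , v) → (u ∈? C) ×-dec (v ∈? C)) edges

record Clustering (n : ℕ) : Set where
  field
    clusters : List (Subset n)
    nonempty : All Nonempty clusters
    disjoint : AllPairs (λ C D → Empty (C ∩ D)) clusters
    covering : ⋃ clusters ≡ ⊤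

open Clustering public

-- A clustering is a set of clusters, so the order of the list is ignored.
-- Repetitions cannot occur, by nonemptiness and disjointness.
infix 4 _≋_

_≋_ : ∀ {n} → Rel (Clustering n) 0ℓ
𝒞 ≋ 𝒟 = clusters 𝒞 ∼[ set ] clusters 𝒟

-- Division with the convention a / 0 = 0. In a connected graph with at
-- least two vertices every nonempty set of vertices has positive volume.
ratio : ℕ → ℕ → ℚ
ratio a zero    = 0ℚ
ratio a (suc b) = + a ℚ./ suc b

module _ {n : ℕ} (G : Graph n) (lam : ℝ) where

  clusterScore : Subset n → ℝ
  clusterScore C =
    lam +ᵣ fromℚ (ratio (2 ℕ.* length (edgesWithin G C)) (vol G C))

  Q : Clustering n → ℝ
  Q 𝒞 = foldr _+ᵣ_ 0ᵣ (map clusterScore (clusters 𝒞))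

  Maximizes : Clustering n → Set
  Maximizes 𝒞 = ∀ 𝒟 → Q 𝒟 ≤ᵣ Q 𝒞

{-# OPTIONS --safe #-}

-- Splitting the arcs u → v with u ∈ C by where v lies gives
-- vol C = 2 |E(C)| + |∂C|, so the density 2 |E(C)| / vol C is at most 1, and by
-- connectedness it equals 1 for a nonempty C only if C = V.
--
-- (a) For λ ≤ -1 every cluster scores at most λ + 1 ≤ 0, so the total is at most
-- the score of any one cluster, hence at most λ + 1, the score of V; equality
-- forces every cluster to have density 1, i.e. to be V.
--
-- (b) For λ ≥ 1 a cluster of size s scores at most s λ: a singleton scores λ, and
-- for s ≥ 2 the density is at most 1 ≤ (s - 1) λ. Equality for s ≥ 2 forces s = 2
-- and density 1, i.e. a cluster V of size 2, excluded by |V| ≥ 3. Since the sizes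
-- sum to n, the total is at most n λ, which the singletons attain.

module Submission where

open import Defs
open import Data.Fin.Base using (Fin; zero; suc)
import Data.Fin.Properties as Fin
open import Data.Fin.Subset using
  (Subset; ⊤; ⋃; _∪_; _∩_; _-_; ∣_∣; _∈_; _⊆_; ⁅_⁆; Nonempty; Empty; inside; outside)
open import Data.Fin.Subset.Properties using
  (_∈?_; ∈⊤; ∉⊥; ⊆⊤; ⊆-refl; ⊆-antisym; x∈⁅x⁆; x∈⁅y⁆⇒x≡y; x∈p∪q⁻; x∈p∪q⁺; x∈p∩q⁻; x∈p∩q⁺;
   drop-∷-Empty; ∪-identityʳ; ∣⊥∣≡0; ∣⊤∣≡n; ∣⁅x⁆∣≡1; p⊂q⇒∣p∣<∣q∣; x∈p⇒∣p-x∣<∣p∣)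
import Data.Integer.Base as ℤ
import Data.Integer.Properties as ℤ
open import Data.List.Base using
  (List; []; _∷_; [_]; _++_; allFin; cartesianProduct; filter; foldr; length; map; tabulate)
open import Data.List.Membership.Propositional using (find) renaming (_∈_ to _∈ₗ_)
open import Data.List.Membership.Propositional.Properties using (∈-tabulate⁺; ∈-tabulate⁻)
open import Data.List.Properties using (filter-none; map-++; map-tabulate; map-∘)
open import Data.List.Relation.Binary.BagAndSetEquality using (_∼[_]_; set)
open import Data.List.Relation.Unary.All as All using (All; []; _∷_)
import Data.List.Relation.Unary.All.Properties as All
open import Data.List.Relation.Unary.AllPairs using (AllPairs; []; _∷_)
import Data.List.Relation.Unary.AllPairs.Properties as AllPairs
open import Data.List.Relation.Unary.Any as Any using (Any; here; there)
open import Data.Nat.Base as ℕ using (ℕ; zero; suc; _+_; _*_; _≤_; _<_; s≤s; z≤n)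
open import Data.Nat.ListAction using (sum)
open import Data.Nat.ListAction.Properties using (sum-++)
import Data.Nat.Properties as ℕ
open import Algebra.Properties.Semiring.Sum ℕ.+-*-semiring using
  (sum-cong-≗; *-distribˡ-sum; ∑-distrib-+; ∑-comm; sum-replicate-zero; sum-syntax)
  renaming (sum to ∑)
open import Data.Product using (_×_; _,_; proj₁; proj₂; ∃!; ∃-syntax)
open import Data.Rational.Base as ℚ using (ℚ; 0ℚ; 1ℚ; ½)
import Data.Rational.Properties as ℚ
open import Data.Rational.Solver using (module +-*-Solver)
import Data.Rational.Unnormalised.Base as ℚᵘ
import Data.Rational.Unnormalised.Properties as ℚᵘ
open import Data.Sum.Base using (inj₁; inj₂)
open import Data.Vec.Base using ([]; _∷_; here)
open import Function.Base using (_∘_; id)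
open import Function.Bundles using (mk⇔)
open import Level using (Level)
open import Relation.Binary.Construct.Closure.ReflexiveTransitive using (Star; _◅_)
open import Relation.Binary.Definitions using (tri<; tri≈; tri>)
open import Relation.Binary.PropositionalEquality using
  (_≡_; _≢_; refl; sym; trans; cong; cong₂; subst; subst₂; module ≡-Reasoning)
open import Relation.Nullary using (Dec; yes; no; ¬_; contradiction)
open import Relation.Nullary.Decidable using (_×-dec_; ¬?; decidable-stable)
open import Relation.Unary using (Pred; Decidable)

-- Indicators and finite sums of natural numbers

private variable
  a p : Level
  A B : Set a

-- The Iverson bracket. It turns lengths of filtered lists into sums whose order can be exchanged.
⟦_⟧ : Dec A → ℕ
⟦ yes _ ⟧ = 1
⟦ no  _ ⟧ = 0

⟦⟧-yes : (a? : Dec A) → A → ⟦ a? ⟧ ≡ 1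
⟦⟧-yes (yes _)  a = refl
⟦⟧-yes (no ¬a) a = contradiction a ¬a

⟦⟧-no : (a? : Dec A) → ¬ A → ⟦ a? ⟧ ≡ 0
⟦⟧-no (yes a) ¬a = contradiction a ¬a
⟦⟧-no (no _)  ¬a = refl

length-filter : ∀ {P : Pred A p} (P? : Decidable P) xs →
  length (filter P? xs) ≡ sum (map (λ x → ⟦ P? x ⟧) xs)
length-filter P? [] = refl
length-filter P? (x ∷ xs) with P? x
... | yes _ = cong suc (length-filter P? xs)
... | no  _ = length-filter P? xs

sum-filter : ∀ {P : Pred A p} (P? : Decidable P) (f : A → ℕ) xs →
  sum (map f (filter P? xs)) ≡ sum (map (λ x → ⟦ P? x ⟧ * f x) xs)
sum-filter P? f [] = refl
sum-filter P? f (x ∷ xs) with P? x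
... | yes _ = cong₂ _+_ (sym (ℕ.+-identityʳ (f x))) (sum-filter P? f xs)
... | no  _ = sum-filter P? f xs

sum-cartesianProduct : ∀ (f : A × B → ℕ) xs ys →
  sum (map f (cartesianProduct xs ys)) ≡
  sum (map (λ x → sum (map (λ y → f (x , y)) ys)) xs)
sum-cartesianProduct f [] ys = refl
sum-cartesianProduct f (x ∷ xs) ys = begin
  sum (map f (map (x ,_) ys ++ cartesianProduct xs ys))
    ≡⟨ cong sum (map-++ f (map (x ,_) ys) _) ⟩
  sum (map f (map (x ,_) ys) ++ map f (cartesianProduct xs ys))
    ≡⟨ sum-++ (map f (map (x ,_) ys)) _ ⟩
  sum (map f (map (x ,_) ys)) + sum (map f (cartesianProduct xs ys))
    ≡⟨ cong₂ _+_ (cong sum (sym (map-∘ ys))) (sum-cartesianProduct f xs ys) ⟩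
  _ ∎
  where open ≡-Reasoning

sum-allFin : ∀ {n} (f : Fin n → ℕ) → sum (map f (allFin n)) ≡ ∑ f
sum-allFin f = trans (cong sum (map-tabulate id f)) (sum-tabulate f)
  where
  sum-tabulate : ∀ {n} (f : Fin n → ℕ) → sum (tabulate f) ≡ ∑ f
  sum-tabulate {zero}  f = refl
  sum-tabulate {suc n} f = cong (f zero +_) (sum-tabulate (f ∘ suc))

∑≡0⇒≗0 : ∀ {n} (f : Fin n → ℕ) → ∑ f ≡ 0 → ∀ i → f i ≡ 0
∑≡0⇒≗0 f eq zero    = ℕ.m+n≡0⇒m≡0 (f zero) eq
∑≡0⇒≗0 f eq (suc i) = ∑≡0⇒≗0 (f ∘ suc) (ℕ.m+n≡0⇒n≡0 (f zero) eq) i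

-- Volume, internal edges and boundary of a vertex set

module _ {n} (G : Graph n) (C : Subset n) where
  open Graph G

  -- Each internal edge contributes only at its ordered pair with `u < v`, as in `edges`.
  edgeWithin : Fin n → Fin n → ℕ
  edgeWithin u v = ⟦ (u Fin.<? v) ×-dec (u ~? v) ⟧ * ⟦ (u ∈? C) ×-dec (v ∈? C) ⟧

  -- Oriented from the endpoint in `C`, so a boundary edge is counted once over all ordered pairs.
  edgeLeaving : Fin n → Fin n → ℕ
  edgeLeaving u v = ⟦ (u ∈? C) ×-dec ((u ~? v) ×-dec ¬? (v ∈? C)) ⟧

  boundary : ℕ
  boundary = ∑[ u < n ] ∑[ v < n ] edgeLeaving u v

  vol-as-sum : vol G C ≡ ∑[ u < n ] ∑[ v < n ] (⟦ u ∈? C ⟧ * ⟦ u ~? v ⟧)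
  vol-as-sum = begin
    vol G C
      ≡⟨ sum-filter (_∈? C) (deg G) (allFin n) ⟩
    sum (map (λ u → ⟦ u ∈? C ⟧ * deg G u) (allFin n))
      ≡⟨ sum-allFin (λ u → ⟦ u ∈? C ⟧ * deg G u) ⟩
    ∑[ u < n ] (⟦ u ∈? C ⟧ * deg G u)
      ≡⟨ sum-cong-≗ (λ u → trans
           (cong (⟦ u ∈? C ⟧ *_)
             (trans (length-filter (u ~?_) (allFin n)) (sum-allFin (λ v → ⟦ u ~? v ⟧))))
           (*-distribˡ-sum ⟦ u ∈? C ⟧ (λ v → ⟦ u ~? v ⟧))) ⟩
    ∑[ u < n ] ∑[ v < n ] (⟦ u ∈? C ⟧ * ⟦ u ~? v ⟧) ∎
    where open ≡-Reasoning

  edgesWithin-as-sum : length (edgesWithin G C) ≡ ∑[ u < n ] ∑[ v < n ] edgeWithin u v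
  edgesWithin-as-sum = begin
    length (edgesWithin G C)
      ≡⟨ length-filter both? (edges G) ⟩
    sum (map (λ e → ⟦ both? e ⟧) (edges G))
      ≡⟨ sum-filter edge? (λ e → ⟦ both? e ⟧) (cartesianProduct (allFin n) (allFin n)) ⟩
    sum (map (λ e → ⟦ edge? e ⟧ * ⟦ both? e ⟧) (cartesianProduct (allFin n) (allFin n)))
      ≡⟨ sum-cartesianProduct (λ e → ⟦ edge? e ⟧ * ⟦ both? e ⟧) (allFin n) (allFin n) ⟩
    sum (map (λ u → sum (map (edgeWithin u) (allFin n))) (allFin n))
      ≡⟨ sum-allFin (λ u → sum (map (edgeWithin u) (allFin n))) ⟩
    ∑[ u < n ] sum (map (edgeWithin u) (allFin n))
      ≡⟨ sum-cong-≗ (λ u → sum-allFin (edgeWithin u)) ⟩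
    ∑[ u < n ] ∑[ v < n ] edgeWithin u v ∎
    where
    open ≡-Reasoning
    both? = λ ((u , v) : Fin n × Fin n) → (u ∈? C) ×-dec (v ∈? C)
    edge? = λ ((u , v) : Fin n × Fin n) → (u Fin.<? v) ×-dec (u ~? v)

  -- An arc that stays in `C` is counted by exactly one of the two `edgeWithin` terms, according to
  -- which endpoint is smaller; irreflexivity rules out `u ≡ v`.
  arc-split : ∀ u v →
    ⟦ u ∈? C ⟧ * ⟦ u ~? v ⟧ ≡ edgeWithin u v + edgeWithin v u + edgeLeaving u v
  arc-split u v with Fin.<-cmp u v | u ~? v
  ... | _ | no u≁v
    rewrite ⟦⟧-no ((u Fin.<? v) ×-dec no u≁v) (u≁v ∘ proj₂)
          | ⟦⟧-no ((v Fin.<? u) ×-dec (v ~? u)) (u≁v ∘ ~-sym ∘ proj₂)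
          | ⟦⟧-no ((u ∈? C) ×-dec (no u≁v ×-dec ¬? (v ∈? C))) (u≁v ∘ proj₁ ∘ proj₂)
    = ℕ.*-zeroʳ ⟦ u ∈? C ⟧
  ... | tri≈ _ u≡v _ | yes u~v = contradiction u~v (~-irrefl u≡v)
  -- With the order and the edge settled, only the two memberships remain to be checked.
  ... | tri< u<v _ v≮u | yes u~v
    rewrite ⟦⟧-yes ((u Fin.<? v) ×-dec yes u~v) (u<v , u~v)
          | ⟦⟧-no ((v Fin.<? u) ×-dec (v ~? u)) (v≮u ∘ proj₁)
    with u ∈? C | v ∈? C
  ...   | yes _ | yes _ = refl
  ...   | yes _ | no  _ = refl
  ...   | no  _ | yes _ = refl
  ...   | no  _ | no  _ = refl
  arc-split u v | tri> u≮v _ v<u | yes u~v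
    rewrite ⟦⟧-yes ((v Fin.<? u) ×-dec (v ~? u)) (v<u , ~-sym u~v)
          | ⟦⟧-no ((u Fin.<? v) ×-dec yes u~v) (u≮v ∘ proj₁)
    with u ∈? C | v ∈? C
  ...   | yes _ | yes _ = refl
  ...   | yes _ | no  _ = refl
  ...   | no  _ | yes _ = refl
  ...   | no  _ | no  _ = refl

  -- Sum `arc-split` over all ordered pairs: exchanging the order of summation makes the two
  -- `edgeWithin` sums equal, whence the factor 2.
  handshake : vol G C ≡ 2 * length (edgesWithin G C) + boundary
  handshake = begin
    vol G C
      ≡⟨ vol-as-sum ⟩
    ∑[ u < n ] ∑[ v < n ] (⟦ u ∈? C ⟧ * ⟦ u ~? v ⟧)
      ≡⟨ sum-cong-≗ (λ u → sum-cong-≗ (arc-split u)) ⟩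
    ∑[ u < n ] ∑[ v < n ] (edgeWithin u v + edgeWithin v u + edgeLeaving u v)
      ≡⟨ sum-cong-≗ (λ u → trans (∑-distrib-+ (λ v → edgeWithin u v + edgeWithin v u) _)
           (cong₂ _+_ (∑-distrib-+ (edgeWithin u) _) refl)) ⟩
    ∑[ u < n ] (∑ (edgeWithin u) + ∑[ v < n ] edgeWithin v u + ∑ (edgeLeaving u))
      ≡⟨ trans (∑-distrib-+ (λ u → ∑ (edgeWithin u) + ∑[ v < n ] edgeWithin v u) _)
           (cong (_+ boundary) (∑-distrib-+ (λ u → ∑ (edgeWithin u)) _)) ⟩
    within + ∑[ u < n ] ∑[ v < n ] edgeWithin v u + boundary
      ≡⟨ cong (λ w → within + w + boundary) (∑-comm (λ u v → edgeWithin v u)) ⟩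
    within + within + boundary
      ≡⟨ cong (λ w → within + w + boundary) (ℕ.+-identityʳ within) ⟨
    2 * within + boundary
      ≡⟨ cong (λ w → 2 * w + boundary) edgesWithin-as-sum ⟨
    2 * length (edgesWithin G C) + boundary ∎
    where
    open ≡-Reasoning
    within = ∑[ u < n ] ∑[ v < n ] edgeWithin u v

  2*edgesWithin≤vol : 2 * length (edgesWithin G C) ≤ vol G C
  2*edgesWithin≤vol = ℕ.≤-trans (ℕ.m≤m+n _ boundary) (ℕ.≤-reflexive (sym handshake))

  -- By `handshake` the boundary is empty, so `C` is closed under adjacency and a path starting in
  -- `C` never leaves it.
  vol≤2*edgesWithin⇒⊤ : Connected G → Nonempty C →
    vol G C ≤ 2 * length (edgesWithin G C) → C ≡ ⊤
  vol≤2*edgesWithin⇒⊤ connected (u , u∈C) vol≤ =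
    ⊆-antisym ⊆⊤ (λ {v} _ → reach (connected u v) u∈C)
    where
    boundary≡0 : boundary ≡ 0
    boundary≡0 = ℕ.n≤0⇒n≡0 (ℕ.+-cancelˡ-≤ w boundary 0 (begin
      w + boundary  ≡⟨ handshake ⟨
      vol G C       ≤⟨ vol≤ ⟩
      w             ≡⟨ ℕ.+-identityʳ w ⟨
      w + 0         ∎))
      where
      open ℕ.≤-Reasoning
      w = 2 * length (edgesWithin G C)

    closed : ∀ {x y} → x ~ y → x ∈ C → y ∈ C
    -- A neighbour outside `C` would put a 1 into the boundary sum, all of whose terms are 0.
    closed {x} {y} x~y x∈C = decidable-stable (y ∈? C) λ y∉C →
      contradiction
        (trans (sym (⟦⟧-yes ((x ∈? C) ×-dec ((x ~? y) ×-dec ¬? (y ∈? C))) (x∈C , x~y , y∉C)))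
          (∑≡0⇒≗0 _ (∑≡0⇒≗0 _ boundary≡0 x) y))
        λ ()

    reach : ∀ {x y} → Star _~_ x y → x ∈ C → y ∈ C
    reach Star.ε       x∈C = x∈C
    reach (x~z ◅ z~*y) x∈C = reach z~*y (closed x~z x∈C)

  singleton⇒noEdgesWithin : ∀ x → C ⊆ ⁅ x ⁆ → length (edgesWithin G C) ≡ 0
  singleton⇒noEdgesWithin x C⊆x = cong length (filter-none _
    (All.map (λ (_ , u~v) (u∈C , v∈C) →
       ~-irrefl (trans (x∈⁅y⁆⇒x≡y x (C⊆x u∈C)) (sym (x∈⁅y⁆⇒x≡y x (C⊆x v∈C)))) u~v)
     (All.all-filter _ (cartesianProduct (allFin n) (allFin n)))))

module _ {n} (G : Graph n) where
  open Graph G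

  2*edgesWithin⊤≡vol⊤ : 2 * length (edgesWithin G ⊤) ≡ vol G ⊤
  2*edgesWithin⊤≡vol⊤ = sym (trans (handshake G ⊤)
    (trans (cong (2 * length (edgesWithin G ⊤) +_) boundary⊤≡0) (ℕ.+-identityʳ _)))
    where
    boundary⊤≡0 : boundary G ⊤ ≡ 0
    boundary⊤≡0 = trans (sum-cong-≗ λ u → trans (sum-cong-≗ λ v →
      ⟦⟧-no ((u ∈? ⊤) ×-dec ((u ~? v) ×-dec ¬? (v ∈? ⊤))) λ (_ , _ , v∉⊤) → v∉⊤ ∈⊤)
      (sum-replicate-zero n)) (sum-replicate-zero n)

  -- The arc from `u` to `v` contributes 1. This keeps the convention `a / 0 = 0` away from the
  -- density of `⊤`.
  vol⊤≢0 : ∀ {u v} → u ~ v → vol G ⊤ ≢ 0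
  vol⊤≢0 {u} {v} u~v vol≡0 = contradiction
    (trans (sym (cong₂ _*_ (⟦⟧-yes (u ∈? ⊤) ∈⊤) (⟦⟧-yes (u ~? v) u~v)))
      (∑≡0⇒≗0 _ (∑≡0⇒≗0 _ (trans (sym (vol-as-sum G ⊤)) vol≡0) u) v))
    λ ()

-- Order and addition of Cauchy reals

-- Abstract, since with-abstraction over halve would otherwise unfold the solver's proof.
abstract
  halve : ∀ {ε} → 0ℚ ℚ.< ε → ∃[ δ ] (0ℚ ℚ.< δ × δ ℚ.+ δ ≡ ε)
  halve {ε} 0<ε = ½ ℚ.* ε
    , subst (ℚ._< ½ ℚ.* ε) (ℚ.*-zeroʳ ½) (ℚ.*-monoʳ-<-pos ½ 0<ε)
    , ½ε+½ε≡ε ε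
    where
    ½ε+½ε≡ε : ∀ ε → ½ ℚ.* ε ℚ.+ ½ ℚ.* ε ≡ ε
    ½ε+½ε≡ε = solve 1 (λ ε → con ½ :* ε :+ con ½ :* ε := ε) refl
      where open +-*-Solver

ℚ-+-cancelˡ-≤ : ∀ p {q} {r} → p ℚ.+ q ℚ.≤ p ℚ.+ r → q ℚ.≤ r
ℚ-+-cancelˡ-≤ p p+q≤p+r = ℚ.≮⇒≥ λ r<q →
  ℚ.<-irrefl refl (ℚ.<-≤-trans (ℚ.+-monoʳ-< p r<q) p+q≤p+r)

ℚ-+-interchange : ∀ p q r s → (p ℚ.+ q) ℚ.+ (r ℚ.+ s) ≡ (p ℚ.+ r) ℚ.+ (q ℚ.+ s)
ℚ-+-interchange = solve 4 (λ p q r s → (p :+ q) :+ (r :+ s) := (p :+ r) :+ (q :+ s)) refl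
  where open +-*-Solver

pointwise⇒≤ᵣ : ∀ x y → (∀ n → seq x n ℚ.≤ seq y n) → x ≤ᵣ y
pointwise⇒≤ᵣ x y x≤y ε 0<ε = 0 , λ n _ →
  subst (ℚ._≤ seq y n ℚ.+ ε) (ℚ.+-identityʳ (seq x n)) (ℚ.+-mono-≤ (x≤y n) (ℚ.<⇒≤ 0<ε))

≗⇒≤ᵣ : ∀ x y → (∀ n → seq x n ≡ seq y n) → x ≤ᵣ y
≗⇒≤ᵣ x y x≗y = pointwise⇒≤ᵣ x y (ℚ.≤-reflexive ∘ x≗y)

≤ᵣ-refl : ∀ x → x ≤ᵣ x
≤ᵣ-refl x = ≗⇒≤ᵣ x x λ _ → refl

≤ᵣ-trans : ∀ x y z → x ≤ᵣ y → y ≤ᵣ z → x ≤ᵣ z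
≤ᵣ-trans x y z x≤y y≤z ε 0<ε with halve 0<ε
... | δ , 0<δ , δ+δ≡ε with x≤y δ 0<δ | y≤z δ 0<δ
...   | M , p | N , q = M ℕ.⊔ N , λ n M⊔N≤n → begin
  seq x n                     ≤⟨ p n (ℕ.m⊔n≤o⇒m≤o M N M⊔N≤n) ⟩
  seq y n ℚ.+ δ               ≤⟨ ℚ.+-monoˡ-≤ δ (q n (ℕ.m⊔n≤o⇒n≤o M N M⊔N≤n)) ⟩
  (seq z n ℚ.+ δ) ℚ.+ δ       ≡⟨ ℚ.+-assoc (seq z n) δ δ ⟩
  seq z n ℚ.+ (δ ℚ.+ δ)       ≡⟨ cong (seq z n ℚ.+_) δ+δ≡ε ⟩
  seq z n ℚ.+ ε               ∎
  where open ℚ.≤-Reasoning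

+ᵣ-mono-≤ : ∀ x y u v → x ≤ᵣ y → u ≤ᵣ v → x +ᵣ u ≤ᵣ y +ᵣ v
+ᵣ-mono-≤ x y u v x≤y u≤v ε 0<ε with halve 0<ε
... | δ , 0<δ , δ+δ≡ε with x≤y δ 0<δ | u≤v δ 0<δ
...   | M , p | N , q = M ℕ.⊔ N , λ n M⊔N≤n → begin
  seq x n ℚ.+ seq u n
    ≤⟨ ℚ.+-mono-≤ (p n (ℕ.m⊔n≤o⇒m≤o M N M⊔N≤n)) (q n (ℕ.m⊔n≤o⇒n≤o M N M⊔N≤n)) ⟩
  (seq y n ℚ.+ δ) ℚ.+ (seq v n ℚ.+ δ)
    ≡⟨ ℚ-+-interchange (seq y n) δ (seq v n) δ ⟩
  (seq y n ℚ.+ seq v n) ℚ.+ (δ ℚ.+ δ)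
    ≡⟨ cong ((seq y n ℚ.+ seq v n) ℚ.+_) δ+δ≡ε ⟩
  (seq y n ℚ.+ seq v n) ℚ.+ ε ∎
  where open ℚ.≤-Reasoning

+ᵣ-monoˡ-≤ : ∀ x y u → x ≤ᵣ y → x +ᵣ u ≤ᵣ y +ᵣ u
+ᵣ-monoˡ-≤ x y u x≤y = +ᵣ-mono-≤ x y u u x≤y (≤ᵣ-refl u)

+ᵣ-monoʳ-≤ : ∀ u x y → x ≤ᵣ y → u +ᵣ x ≤ᵣ u +ᵣ y
+ᵣ-monoʳ-≤ u x y = +ᵣ-mono-≤ u u x y (≤ᵣ-refl u)

+ᵣ-cancelˡ-≤ : ∀ x y z → x +ᵣ y ≤ᵣ x +ᵣ z → y ≤ᵣ z
+ᵣ-cancelˡ-≤ x y z x+y≤x+z ε 0<ε with x+y≤x+z ε 0<ε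
... | N , p = N , λ n N≤n → ℚ-+-cancelˡ-≤ (seq x n) (begin
  seq x n ℚ.+ seq y n            ≤⟨ p n N≤n ⟩
  (seq x n ℚ.+ seq z n) ℚ.+ ε    ≡⟨ ℚ.+-assoc (seq x n) (seq z n) ε ⟩
  seq x n ℚ.+ (seq z n ℚ.+ ε)    ∎)
  where open ℚ.≤-Reasoning

fromℚ-mono-≤ : ∀ p q → p ℚ.≤ q → fromℚ p ≤ᵣ fromℚ q
fromℚ-mono-≤ p q p≤q = pointwise⇒≤ᵣ (fromℚ p) (fromℚ q) λ _ → p≤q

-- If `q < p`, choose `m` strictly between them; the tolerance `m - q` then yields `p ≤ m`, a
-- contradiction.
fromℚ-cancel-≤ : ∀ p q → fromℚ p ≤ᵣ fromℚ q → p ℚ.≤ q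
fromℚ-cancel-≤ p q p≤q = ℚ.≮⇒≥ contra
  where
  contra : ¬ (q ℚ.< p)
  contra q<p with ℚ.<-dense q<p
  ... | m , q<m , m<p
    with p≤q (m ℚ.- q) (subst (ℚ._< m ℚ.- q) (ℚ.+-inverseʳ q) (ℚ.+-monoˡ-< (ℚ.- q) q<m))
  ...   | N , h = ℚ.<-irrefl refl (ℚ.<-≤-trans m<p
    (subst (p ℚ.≤_) (q+[m-q]≡m q m) (h N ℕ.≤-refl)))
    where
    q+[m-q]≡m : ∀ q m → q ℚ.+ (m ℚ.- q) ≡ m
    q+[m-q]≡m = solve 2 (λ q m → q :+ (m :- q) := m) refl
      where open +-*-Solver

-- Natural multiples and finite sums of reals

infixr 7 _·_

-- Repeated addition, so that `suc m · lam` unfolds to `lam +ᵣ m · lam`, whose first term matches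
-- the `lam` in a cluster's score.
_·_ : ℕ → ℝ → ℝ
zero  · x = 0ᵣ
suc m · x = x +ᵣ m · x

-- Stated for each term of the sequences; `≗⇒≤ᵣ` turns such an equality into an inequality of reals
-- in either direction.
·-distribʳ-+ : ∀ m n x k → seq (m · x +ᵣ n · x) k ≡ seq ((m + n) · x) k
·-distribʳ-+ zero    n x k = ℚ.+-identityˡ _
·-distribʳ-+ (suc m) n x k =
  trans (ℚ.+-assoc (seq x k) _ _) (cong (seq x k ℚ.+_) (·-distribʳ-+ m n x k))

0≤y⇒x≤x+y : ∀ x y → 0ᵣ ≤ᵣ y → x ≤ᵣ x +ᵣ y
0≤y⇒x≤x+y x y 0≤y = ≤ᵣ-trans x (x +ᵣ 0ᵣ) (x +ᵣ y)
  (≗⇒≤ᵣ x (x +ᵣ 0ᵣ) λ k → sym (ℚ.+-identityʳ (seq x k)))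
  (+ᵣ-monoʳ-≤ x 0ᵣ y 0≤y)

y≤0⇒x+y≤x : ∀ x y → y ≤ᵣ 0ᵣ → x +ᵣ y ≤ᵣ x
y≤0⇒x+y≤x x y y≤0 = ≤ᵣ-trans (x +ᵣ y) (x +ᵣ 0ᵣ) x
  (+ᵣ-monoʳ-≤ x y 0ᵣ y≤0)
  (≗⇒≤ᵣ (x +ᵣ 0ᵣ) x λ k → ℚ.+-identityʳ (seq x k))

0≤n·x : ∀ n x → 0ᵣ ≤ᵣ x → 0ᵣ ≤ᵣ n · x
0≤n·x zero    x 0≤x = ≤ᵣ-refl 0ᵣ
0≤n·x (suc n) x 0≤x = ≤ᵣ-trans 0ᵣ x (x +ᵣ n · x) 0≤x (0≤y⇒x≤x+y x (n · x) (0≤n·x n x 0≤x))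

1≤[1+n]·x : ∀ n x → 1ᵣ ≤ᵣ x → 1ᵣ ≤ᵣ suc n · x
1≤[1+n]·x n x 1≤x = ≤ᵣ-trans 1ᵣ x (x +ᵣ n · x) 1≤x (0≤y⇒x≤x+y x (n · x) (0≤n·x n x 0≤x))
  where
  0≤x : 0ᵣ ≤ᵣ x
  0≤x = ≤ᵣ-trans 0ᵣ 1ᵣ x (fromℚ-mono-≤ 0ℚ 1ℚ (ℚ.nonNegative⁻¹ 1ℚ)) 1≤x

-- Has the shape of `Q`, which is therefore definitionally such a sum of cluster scores.
∑ᵣ : (A → ℝ) → List A → ℝ
∑ᵣ f xs = foldr _+ᵣ_ 0ᵣ (map f xs)

∑ᵣ-mono-≤ : (f g : A → ℝ) {xs : List A} → All (λ x → f x ≤ᵣ g x) xs → ∑ᵣ f xs ≤ᵣ ∑ᵣ g xs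
∑ᵣ-mono-≤ f g [] = ≤ᵣ-refl 0ᵣ
∑ᵣ-mono-≤ f g {x ∷ xs} (fx≤gx ∷ f≤g) =
  +ᵣ-mono-≤ (f x) (g x) (∑ᵣ f xs) (∑ᵣ g xs) fx≤gx (∑ᵣ-mono-≤ f g f≤g)

-- When the two sums agree, cancelling them leaves g x ≤ f x: equality holds termwise.
∑ᵣ-mono-≤-at : (f g : A → ℝ) {xs : List A} → All (λ x → f x ≤ᵣ g x) xs →
  ∀ {x} → x ∈ₗ xs → ∑ᵣ f xs +ᵣ g x ≤ᵣ ∑ᵣ g xs +ᵣ f x
∑ᵣ-mono-≤-at f g {x ∷ xs} (_ ∷ f≤g) (here refl) =
  ≤ᵣ-trans ((f x +ᵣ ∑ᵣ f xs) +ᵣ g x) ((f x +ᵣ ∑ᵣ g xs) +ᵣ g x) ((g x +ᵣ ∑ᵣ g xs) +ᵣ f x)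
    (+ᵣ-monoˡ-≤ (f x +ᵣ ∑ᵣ f xs) (f x +ᵣ ∑ᵣ g xs) (g x)
      (+ᵣ-monoʳ-≤ (f x) (∑ᵣ f xs) (∑ᵣ g xs) (∑ᵣ-mono-≤ f g f≤g)))
    (≗⇒≤ᵣ ((f x +ᵣ ∑ᵣ g xs) +ᵣ g x) ((g x +ᵣ ∑ᵣ g xs) +ᵣ f x) λ k →
      swap (seq (f x) k) (seq (∑ᵣ g xs) k) (seq (g x) k))
  where
  swap : ∀ p q r → (p ℚ.+ q) ℚ.+ r ≡ (r ℚ.+ q) ℚ.+ p
  swap = solve 3 (λ p q r → (p :+ q) :+ r := (r :+ q) :+ p) refl
    where open +-*-Solver
∑ᵣ-mono-≤-at f g {y ∷ xs} (fy≤gy ∷ f≤g) {x} (there x∈xs) =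
  ≤ᵣ-trans ((f y +ᵣ ∑ᵣ f xs) +ᵣ g x) (f y +ᵣ (∑ᵣ f xs +ᵣ g x)) ((g y +ᵣ ∑ᵣ g xs) +ᵣ f x)
    (≗⇒≤ᵣ ((f y +ᵣ ∑ᵣ f xs) +ᵣ g x) (f y +ᵣ (∑ᵣ f xs +ᵣ g x)) λ k → ℚ.+-assoc (seq (f y) k) _ _)
    (≤ᵣ-trans (f y +ᵣ (∑ᵣ f xs +ᵣ g x)) (g y +ᵣ (∑ᵣ g xs +ᵣ f x)) ((g y +ᵣ ∑ᵣ g xs) +ᵣ f x)
      (+ᵣ-mono-≤ (f y) (g y) (∑ᵣ f xs +ᵣ g x) (∑ᵣ g xs +ᵣ f x) fy≤gy (∑ᵣ-mono-≤-at f g f≤g x∈xs))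
      (≗⇒≤ᵣ (g y +ᵣ (∑ᵣ g xs +ᵣ f x)) ((g y +ᵣ ∑ᵣ g xs) +ᵣ f x) λ k →
        sym (ℚ.+-assoc (seq (g y) k) _ _)))

-- Collects the bounds for single clusters into one multiple of `lam`, governed by the total size.
∑ᵣ-· : ∀ (f : A → ℕ) x xs k → seq (∑ᵣ (λ y → f y · x) xs) k ≡ seq (sum (map f xs) · x) k
∑ᵣ-· f x []       k = refl
∑ᵣ-· f x (y ∷ ys) k =
  trans (cong (seq (f y · x) k ℚ.+_) (∑ᵣ-· f x ys k)) (·-distribʳ-+ (f y) _ x k)

-- Comparing ratios with 1

ratio≤1 : ∀ {a b} → a ≤ b → ratio a b ℚ.≤ 1ℚ
ratio≤1 {b = zero}      _     = ℚ.nonNegative⁻¹ 1ℚ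
ratio≤1 {a} {b = suc b} a≤b = ℚ.toℚᵘ-cancel-≤
  (ℚᵘ.≤-respˡ-≃ (ℚᵘ.≃-sym (ℚ.toℚᵘ-fromℚᵘ (ℚᵘ.mkℚᵘ (ℤ.+ a) b)))
    (ℚᵘ.*≤* (subst₂ ℤ._≤_
      (sym (ℤ.*-identityʳ (ℤ.+ a))) (sym (ℤ.*-identityˡ (ℤ.+ suc b))) (ℤ.+≤+ a≤b))))

1≤ratio⇒≥ : ∀ {a} b → 1ℚ ℚ.≤ ratio a b → b ≤ a
1≤ratio⇒≥ zero    _ = z≤n
1≤ratio⇒≥ {a} (suc b) 1≤r
  with ℚᵘ.≤-respʳ-≃ (ℚ.toℚᵘ-fromℚᵘ (ℚᵘ.mkℚᵘ (ℤ.+ a) b)) (ℚ.toℚᵘ-mono-≤ 1≤r)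
... | ℚᵘ.*≤* h = ℤ.drop‿+≤+ (subst₂ ℤ._≤_ (ℤ.*-identityˡ (ℤ.+ suc b)) (ℤ.*-identityʳ (ℤ.+ a)) h)

1≤ratio-diagonal : ∀ {a} → a ≢ 0 → 1ℚ ℚ.≤ ratio a a
1≤ratio-diagonal {zero}  a≢0 = contradiction refl a≢0
1≤ratio-diagonal {suc a} _   = ℚ.toℚᵘ-cancel-≤
  (ℚᵘ.≤-respʳ-≃ (ℚᵘ.≃-sym (ℚ.toℚᵘ-fromℚᵘ (ℚᵘ.mkℚᵘ (ℤ.+ suc a) a)))
    (ℚᵘ.*≤* (ℤ.≤-reflexive (ℤ.*-comm (ℤ.+ 1) (ℤ.+ suc a)))))

ratio-zeroˡ : ∀ b → ratio 0 b ≡ 0ℚ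
ratio-zeroˡ zero    = refl
ratio-zeroˡ (suc b) = ℚ.fromℚᵘ-cong {ℚᵘ.mkℚᵘ (ℤ.+ 0) b} {ℚᵘ.0ℚᵘ} (ℚᵘ.*≡* refl)

-- Unions and sizes of subsets

∈⋃⁻ : ∀ {n} {x : Fin n} Cs → x ∈ ⋃ Cs → Any (x ∈_) Cs
∈⋃⁻ []       x∈⊥ = contradiction x∈⊥ ∉⊥
∈⋃⁻ (C ∷ Cs) x∈  with x∈p∪q⁻ C (⋃ Cs) x∈
... | inj₁ x∈C  = here x∈C
... | inj₂ x∈Cs = there (∈⋃⁻ Cs x∈Cs)

∈⋃⁺ : ∀ {n} {x : Fin n} {Cs} → Any (x ∈_) Cs → x ∈ ⋃ Cs
∈⋃⁺ (here x∈C)   = x∈p∪q⁺ (inj₁ x∈C)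
∈⋃⁺ (there x∈Cs) = x∈p∪q⁺ (inj₂ (∈⋃⁺ x∈Cs))

disjoint⇒∣p∪q∣≡∣p∣+∣q∣ : ∀ {n} (p q : Subset n) → Empty (p ∩ q) → ∣ p ∪ q ∣ ≡ ∣ p ∣ + ∣ q ∣
disjoint⇒∣p∪q∣≡∣p∣+∣q∣ []            []            _  = refl
disjoint⇒∣p∪q∣≡∣p∣+∣q∣ (inside  ∷ p) (inside  ∷ q) p∦q = contradiction (zero , here) p∦q
disjoint⇒∣p∪q∣≡∣p∣+∣q∣ (inside  ∷ p) (outside ∷ q) p∦q =
  cong suc (disjoint⇒∣p∪q∣≡∣p∣+∣q∣ p q (drop-∷-Empty p∦q))
disjoint⇒∣p∪q∣≡∣p∣+∣q∣ (outside ∷ p) (inside  ∷ q) p∦q =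
  trans (cong suc (disjoint⇒∣p∪q∣≡∣p∣+∣q∣ p q (drop-∷-Empty p∦q))) (sym (ℕ.+-suc ∣ p ∣ ∣ q ∣))
disjoint⇒∣p∪q∣≡∣p∣+∣q∣ (outside ∷ p) (outside ∷ q) p∦q =
  disjoint⇒∣p∪q∣≡∣p∣+∣q∣ p q (drop-∷-Empty p∦q)

∣⋃∣≡sum : ∀ {n} {Cs : List (Subset n)} → AllPairs (λ C D → Empty (C ∩ D)) Cs →
  ∣ ⋃ Cs ∣ ≡ sum (map ∣_∣ Cs)
∣⋃∣≡sum {n} [] = ∣⊥∣≡0 n
∣⋃∣≡sum {Cs = C ∷ Cs} (C∦Cs ∷ Cs∦) =
  trans (disjoint⇒∣p∪q∣≡∣p∣+∣q∣ C (⋃ Cs) C∦⋃Cs) (cong₂ _+_ refl (∣⋃∣≡sum Cs∦))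
  where
  C∦⋃Cs : Empty (C ∩ ⋃ Cs)
  C∦⋃Cs (x , x∈) with x∈p∩q⁻ C (⋃ Cs) x∈
  ... | x∈C , x∈⋃ with All.lookupAny C∦Cs (∈⋃⁻ Cs x∈⋃)
  ...   | C∦D , x∈D = C∦D (x , x∈p∩q⁺ (x∈C , x∈D))

-- A second element would make `⁅ x ⁆` a proper subset of `p`, and `p` would have more than one
-- element.
∣p∣≡1⇒p≡⁅x⁆ : ∀ {n} {p : Subset n} {x} → ∣ p ∣ ≡ 1 → x ∈ p → p ≡ ⁅ x ⁆
∣p∣≡1⇒p≡⁅x⁆ {p = p} {x} ∣p∣≡1 x∈p = ⊆-antisym p⊆⁅x⁆ ⁅x⁆⊆p
  where
  ⁅x⁆⊆p : ⁅ x ⁆ ⊆ p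
  ⁅x⁆⊆p y∈⁅x⁆ = subst (_∈ p) (sym (x∈⁅y⁆⇒x≡y x y∈⁅x⁆)) x∈p

  p⊆⁅x⁆ : p ⊆ ⁅ x ⁆
  p⊆⁅x⁆ {y} y∈p = decidable-stable (y ∈? ⁅ x ⁆) λ y∉⁅x⁆ → ℕ.<-irrefl
    (trans (∣⁅x⁆∣≡1 x) (sym ∣p∣≡1)) (p⊂q⇒∣p∣<∣q∣ (⁅x⁆⊆p , y , y∈p , y∉⁅x⁆))

nonempty⇒∣p∣≢0 : ∀ {n} {p : Subset n} → Nonempty p → ∣ p ∣ ≢ 0
nonempty⇒∣p∣≢0 {p = p} (x , x∈p) ∣p∣≡0 = ℕ.n≮0 (subst (∣ p - x ∣ <_) ∣p∣≡0 (x∈p⇒∣p-x∣<∣p∣ x∈p))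

-- Makes the upper bound for λ ≥ 1 the same for every clustering.
∑∣cluster∣≡n : ∀ {n} (𝒞 : Clustering n) → sum (map ∣_∣ (clusters 𝒞)) ≡ n
∑∣cluster∣≡n {n} 𝒞 = trans (sym (∣⋃∣≡sum (disjoint 𝒞)))
  (trans (cong ∣_∣ (covering 𝒞)) (∣⊤∣≡n n))

-- The two extremal clusterings

oneCluster : ∀ {n} → Fin n → Clustering n
oneCluster x = record
  { clusters = [ ⊤ ]
  ; nonempty = (x , ∈⊤) ∷ []
  ; disjoint = [] ∷ []
  ; covering = ∪-identityʳ ⊤
  }

singletons : ∀ n → Clustering n
singletons n = record
  { clusters = tabulate ⁅_⁆
  ; nonempty = All.tabulate⁺ λ x → x , x∈⁅x⁆ x
  ; disjoint = AllPairs.tabulate⁺ λ {x} {y} x≢y (z , z∈) →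
      let z∈x , z∈y = x∈p∩q⁻ ⁅ x ⁆ ⁅ y ⁆ z∈ in
      x≢y (trans (sym (x∈⁅y⁆⇒x≡y x z∈x)) (x∈⁅y⁆⇒x≡y y z∈y))
  ; covering = ⊆-antisym ⊆⊤ λ {x} _ →
      ∈⋃⁺ (Any.map (λ eq → subst (x ∈_) eq (x∈⁅x⁆ x)) (∈-tabulate⁺ x))
  }

-- A cluster of size 1 is `⁅ x ⁆` for its element `x`, and covering puts every vertex into some
-- cluster.
allSingletons⇒≋ : ∀ {n} (𝒞 : Clustering n) →
  All (λ C → ∣ C ∣ ≡ 1) (clusters 𝒞) → singletons n ≋ 𝒞
allSingletons⇒≋ {n} 𝒞 size1 {C} = mk⇔ to from
  where
  to : C ∈ₗ tabulate ⁅_⁆ → C ∈ₗ clusters 𝒞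
  to C∈ with ∈-tabulate⁻ C∈
  ... | x , refl with find (∈⋃⁻ (clusters 𝒞) (subst (x ∈_) (sym (covering 𝒞)) ∈⊤))
  ...   | D , D∈ , x∈D =
    subst (_∈ₗ clusters 𝒞) (∣p∣≡1⇒p≡⁅x⁆ (All.lookup size1 D∈) x∈D) D∈

  from : C ∈ₗ clusters 𝒞 → C ∈ₗ tabulate ⁅_⁆
  from C∈ with All.lookup (nonempty 𝒞) C∈
  ... | x , x∈C = subst (_∈ₗ tabulate ⁅_⁆)
    (sym (∣p∣≡1⇒p≡⁅x⁆ (All.lookup size1 C∈) x∈C)) (∈-tabulate⁺ x)

-- Density of a cluster

module _ {n} (G : Graph n) where
  open Graph G using (_~_)

  density : Subset n → ℚ
  density C = ratio (2 * length (edgesWithin G C)) (vol G C)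

  density≤1 : ∀ C → density C ℚ.≤ 1ℚ
  density≤1 C = ratio≤1 (2*edgesWithin≤vol G C)

  1≤density⇒⊤ : ∀ {C} → Connected G → Nonempty C → 1ℚ ℚ.≤ density C → C ≡ ⊤
  1≤density⇒⊤ {C} connected ne 1≤d =
    vol≤2*edgesWithin⇒⊤ G C connected ne (1≤ratio⇒≥ (vol G C) 1≤d)

  1≤density⊤ : ∀ {u v} → u ~ v → 1ℚ ℚ.≤ density ⊤
  1≤density⊤ u~v = subst (λ a → 1ℚ ℚ.≤ ratio a (vol G ⊤))
    (sym (2*edgesWithin⊤≡vol⊤ G)) (1≤ratio-diagonal (vol⊤≢0 G u~v))

  density-singleton : ∀ {C} → ∣ C ∣ ≡ 1 → Nonempty C → density C ≡ 0ℚ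
  density-singleton {C} ∣C∣≡1 (x , x∈C) = trans
    (cong (λ e → ratio (2 * e) (vol G C)) (singleton⇒noEdgesWithin G C x
      (subst (C ⊆_) (∣p∣≡1⇒p≡⁅x⁆ ∣C∣≡1 x∈C) ⊆-refl)))
    (ratio-zeroˡ (vol G C))

module _ {n} (G : Graph n) (connected : Connected G) (lam : ℝ) where

  score : Subset n → ℝ
  score = clusterScore G lam

  -- The case λ ≤ -1

  module _ {u v} (u~v : Graph._~_ G u v) (lam≤-1 : lam ≤ᵣ -1ᵣ) where

    score≤lam+1 : ∀ C → score C ≤ᵣ lam +ᵣ 1ᵣ
    score≤lam+1 C = +ᵣ-monoʳ-≤ lam (fromℚ (density G C)) 1ᵣ
      (fromℚ-mono-≤ (density G C) 1ℚ (density≤1 G C))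

    score≤0 : ∀ C → score C ≤ᵣ 0ᵣ
    score≤0 C = ≤ᵣ-trans (score C) (lam +ᵣ 1ᵣ) 0ᵣ (score≤lam+1 C)
      (≤ᵣ-trans (lam +ᵣ 1ᵣ) (-1ᵣ +ᵣ 1ᵣ) 0ᵣ (+ᵣ-monoˡ-≤ lam -1ᵣ 1ᵣ lam≤-1)
        (≗⇒≤ᵣ (-1ᵣ +ᵣ 1ᵣ) 0ᵣ λ _ → refl))

    ∑score≤0 : ∀ Cs → ∑ᵣ score Cs ≤ᵣ 0ᵣ
    ∑score≤0 []       = ≤ᵣ-refl 0ᵣ
    ∑score≤0 (C ∷ Cs) = ≤ᵣ-trans (score C +ᵣ ∑ᵣ score Cs) (score C) 0ᵣ
      (y≤0⇒x+y≤x (score C) (∑ᵣ score Cs) (∑score≤0 Cs)) (score≤0 C)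

    -- The first cluster is compared with `⊤`, whose density is at least 1, and all the others
    -- together with the `0ᵣ` that ends the sum over `[ ⊤ ]`.
    cover⇒∑score≤score⊤ : ∀ Cs → ⋃ Cs ≡ ⊤ → ∑ᵣ score Cs ≤ᵣ ∑ᵣ score [ ⊤ ]
    cover⇒∑score≤score⊤ []       ⊥≡⊤ = contradiction (subst (u ∈_) (sym ⊥≡⊤) ∈⊤) ∉⊥
    cover⇒∑score≤score⊤ (C ∷ Cs) _   = +ᵣ-mono-≤ (score C) (score ⊤) (∑ᵣ score Cs) 0ᵣ
      (≤ᵣ-trans (score C) (lam +ᵣ 1ᵣ) (score ⊤) (score≤lam+1 C)
        (+ᵣ-monoʳ-≤ lam 1ᵣ (fromℚ (density G ⊤))
          (fromℚ-mono-≤ 1ℚ (density G ⊤) (1≤density⊤ G u~v))))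
      (∑score≤0 Cs)

    -- The other clusters add at most 0, so `score C` alone reaches `score ⊤`; cancelling `lam`
    -- leaves a density of at least 1.
    score⊤≤∑score⇒head≡⊤ : ∀ {C} Cs → Nonempty C →
      ∑ᵣ score [ ⊤ ] ≤ᵣ ∑ᵣ score (C ∷ Cs) → C ≡ ⊤
    score⊤≤∑score⇒head≡⊤ {C} Cs ne score⊤≤ =
      1≤density⇒⊤ G connected ne (ℚ.≤-trans (1≤density⊤ G u~v)
        (fromℚ-cancel-≤ (density G ⊤) (density G C)
          (+ᵣ-cancelˡ-≤ lam (fromℚ (density G ⊤)) (fromℚ (density G C))
            (≤ᵣ-trans (score ⊤) (score ⊤ +ᵣ 0ᵣ) (score C)
              (0≤y⇒x≤x+y (score ⊤) 0ᵣ (≤ᵣ-refl 0ᵣ))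
              (≤ᵣ-trans (score ⊤ +ᵣ 0ᵣ) (score C +ᵣ ∑ᵣ score Cs) (score C) score⊤≤
                (y≤0⇒x+y≤x (score C) (∑ᵣ score Cs) (∑score≤0 Cs)))))))

    score⊤≤∑score⇒[⊤] : ∀ Cs → All Nonempty Cs → AllPairs (λ C D → Empty (C ∩ D)) Cs →
      ⋃ Cs ≡ ⊤ → ∑ᵣ score [ ⊤ ] ≤ᵣ ∑ᵣ score Cs → Cs ≡ [ ⊤ ]
    score⊤≤∑score⇒[⊤] [] _ _ ⊥≡⊤ _ = contradiction (subst (u ∈_) (sym ⊥≡⊤) ∈⊤) ∉⊥
    score⊤≤∑score⇒[⊤] (C ∷ []) (ne ∷ _) _ _ score⊤≤ =
      cong [_] (score⊤≤∑score⇒head≡⊤ [] ne score⊤≤)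
    -- A second cluster is nonempty, so it meets the first one, which is `⊤`.
    score⊤≤∑score⇒[⊤] (C ∷ D ∷ Ds) (ne ∷ (x , x∈D) ∷ _) ((C∦D ∷ _) ∷ _) _ score⊤≤ =
      contradiction (x , x∈p∩q⁺ (x∈C , x∈D)) C∦D
      where
      x∈C : x ∈ C
      x∈C = subst (x ∈_) (sym (score⊤≤∑score⇒head≡⊤ (D ∷ Ds) ne score⊤≤)) ∈⊤

    oneCluster-maximizes : Maximizes G lam (oneCluster u)
    oneCluster-maximizes 𝒟 = cover⇒∑score≤score⊤ (clusters 𝒟) (covering 𝒟)

    maximizes⇒oneCluster : ∀ 𝒞 → Maximizes G lam 𝒞 → clusters 𝒞 ≡ [ ⊤ ]
    maximizes⇒oneCluster 𝒞 max = score⊤≤∑score⇒[⊤] (clusters 𝒞) (nonempty 𝒞) (disjoint 𝒞)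
      (covering 𝒞) (max (oneCluster u))

  -- The case λ ≥ 1

  module _ (3≤n : 3 ≤ n) (1≤lam : 1ᵣ ≤ᵣ lam) where

    size·lam : Subset n → ℝ
    size·lam C = ∣ C ∣ · lam

    -- Once the common `lam` is removed, the density faces `m - 1` copies of `lam`: none for size 1,
    -- where the density is 0, and a total of at least 1 beyond.
    score≤size·lam : ∀ {C} → Nonempty C → score C ≤ᵣ size·lam C
    score≤size·lam {C} ne = bound ∣ C ∣ refl
      where
      bound : ∀ m → ∣ C ∣ ≡ m → score C ≤ᵣ m · lam
      bound 0 ∣C∣≡0 = contradiction ∣C∣≡0 (nonempty⇒∣p∣≢0 ne)
      bound 1 ∣C∣≡1 = +ᵣ-monoʳ-≤ lam (fromℚ (density G C)) 0ᵣ
        (fromℚ-mono-≤ (density G C) 0ℚ (ℚ.≤-reflexive (density-singleton G ∣C∣≡1 ne)))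
      bound (suc (suc t)) _ = +ᵣ-monoʳ-≤ lam (fromℚ (density G C)) (suc t · lam)
        (≤ᵣ-trans (fromℚ (density G C)) 1ᵣ (suc t · lam)
          (fromℚ-mono-≤ (density G C) 1ℚ (density≤1 G C))
          (1≤[1+n]·x t lam 1≤lam))

    -- For size `s`, cancelling one `lam` leaves `s - 1` copies of it below the density; `tooLarge`
    -- refutes this from size 2 on.
    size·lam≤score⇒singleton : ∀ {C} → Nonempty C → size·lam C ≤ᵣ score C → ∣ C ∣ ≡ 1
    size·lam≤score⇒singleton {C} ne = size≡1 ∣ C ∣ refl
      where
      d = density G C

      tooLarge : ∀ t → ∣ C ∣ ≡ suc (suc t) → ¬ (suc t · lam ≤ᵣ fromℚ d)
      -- Size 2: the density is at least 1, so `C` is `⊤` and `n` is 2, against `3 ≤ n`.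
      tooLarge zero ∣C∣≡2 lb = ℕ.<-irrefl
        (trans (sym ∣C∣≡2) (trans (cong ∣_∣ C≡⊤) (∣⊤∣≡n n))) 3≤n
        where
        C≡⊤ : C ≡ ⊤
        C≡⊤ = 1≤density⇒⊤ G connected ne (fromℚ-cancel-≤ 1ℚ d
          (≤ᵣ-trans 1ᵣ (1 · lam) (fromℚ d) (1≤[1+n]·x 0 lam 1≤lam) lb))
      -- Size at least 3: two or more copies of `lam` force a density of at least 2.
      tooLarge (suc t) _ lb = ℚ.<-irrefl refl (ℚ.<-≤-trans
        (ℚ.+-monoʳ-< 1ℚ (ℚ.positive⁻¹ 1ℚ))
        (ℚ.≤-trans (fromℚ-cancel-≤ (1ℚ ℚ.+ 1ℚ) d 2≤d) (density≤1 G C)))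
        where
        2≤d : fromℚ (1ℚ ℚ.+ 1ℚ) ≤ᵣ fromℚ d
        2≤d = ≤ᵣ-trans (fromℚ (1ℚ ℚ.+ 1ℚ)) (1ᵣ +ᵣ 1ᵣ) (fromℚ d)
          (≗⇒≤ᵣ (fromℚ (1ℚ ℚ.+ 1ℚ)) (1ᵣ +ᵣ 1ᵣ) λ _ → refl)
          (≤ᵣ-trans (1ᵣ +ᵣ 1ᵣ) (lam +ᵣ suc t · lam) (fromℚ d)
            (+ᵣ-mono-≤ 1ᵣ lam 1ᵣ (suc t · lam) 1≤lam (1≤[1+n]·x t lam 1≤lam)) lb)

      size≡1 : ∀ m → ∣ C ∣ ≡ m → m · lam ≤ᵣ score C → m ≡ 1
      size≡1 0 ∣C∣≡0 _ = contradiction ∣C∣≡0 (nonempty⇒∣p∣≢0 ne)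
      size≡1 1 _     _ = refl
      size≡1 (suc (suc t)) ∣C∣≡2+t lb =
        contradiction (+ᵣ-cancelˡ-≤ lam (suc t · lam) (fromℚ d) lb) (tooLarge t ∣C∣≡2+t)

    singleton⇒size·lam≤score : ∀ {C} → Nonempty C → ∣ C ∣ ≡ 1 → size·lam C ≤ᵣ score C
    singleton⇒size·lam≤score {C} ne ∣C∣≡1 =
      subst₂ (λ m q → m · lam ≤ᵣ lam +ᵣ fromℚ q) (sym ∣C∣≡1) (sym (density-singleton G ∣C∣≡1 ne))
        (≤ᵣ-refl (lam +ᵣ 0ᵣ))

    ∑size·lam : ∀ 𝒞 k → seq (∑ᵣ size·lam (clusters 𝒞)) k ≡ seq (n · lam) k
    ∑size·lam 𝒞 k = trans (∑ᵣ-· ∣_∣ lam (clusters 𝒞) k)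
      (cong (λ m → seq (m · lam) k) (∑∣cluster∣≡n 𝒞))

    ∑size·lam≤∑size·lam : ∀ 𝒞 𝒟 →
      ∑ᵣ size·lam (clusters 𝒞) ≤ᵣ ∑ᵣ size·lam (clusters 𝒟)
    ∑size·lam≤∑size·lam 𝒞 𝒟 =
      ≗⇒≤ᵣ (∑ᵣ size·lam (clusters 𝒞)) (∑ᵣ size·lam (clusters 𝒟)) λ k →
        trans (∑size·lam 𝒞 k) (sym (∑size·lam 𝒟 k))

    Q≤∑size·lam : ∀ 𝒞 → Q G lam 𝒞 ≤ᵣ ∑ᵣ size·lam (clusters 𝒞)
    Q≤∑size·lam 𝒞 = ∑ᵣ-mono-≤ score size·lam (All.map score≤size·lam (nonempty 𝒞))

    ∑size·lam≤Qsingletons : ∑ᵣ size·lam (clusters (singletons n)) ≤ᵣ Q G lam (singletons n)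
    ∑size·lam≤Qsingletons = ∑ᵣ-mono-≤ size·lam score
      (All.tabulate⁺ λ x → singleton⇒size·lam≤score (x , x∈⁅x⁆ x) (∣⁅x⁆∣≡1 x))

    singletons-maximizes : Maximizes G lam (singletons n)
    singletons-maximizes 𝒟 =
      ≤ᵣ-trans (Q G lam 𝒟) (∑ᵣ size·lam (clusters 𝒟)) (Q G lam (singletons n)) (Q≤∑size·lam 𝒟)
        (≤ᵣ-trans (∑ᵣ size·lam (clusters 𝒟)) (∑ᵣ size·lam (clusters (singletons n)))
          (Q G lam (singletons n))
          (∑size·lam≤∑size·lam 𝒟 (singletons n)) ∑size·lam≤Qsingletons)

    -- A maximizer reaches the upper bound `S`, so by `∑ᵣ-mono-≤-at` every single cluster attains
    -- its own bound.
    maximizes⇒allSingletons : ∀ 𝒞 → Maximizes G lam 𝒞 → All (λ C → ∣ C ∣ ≡ 1) (clusters 𝒞)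
    maximizes⇒allSingletons 𝒞 max = All.tabulate λ {C} C∈ →
      size·lam≤score⇒singleton (All.lookup (nonempty 𝒞) C∈)
        (+ᵣ-cancelˡ-≤ S (size·lam C) (score C)
          (≤ᵣ-trans (S +ᵣ size·lam C) (Q G lam 𝒞 +ᵣ size·lam C) (S +ᵣ score C)
            (+ᵣ-monoˡ-≤ S (Q G lam 𝒞) (size·lam C) S≤Q)
            (∑ᵣ-mono-≤-at score size·lam (All.map score≤size·lam (nonempty 𝒞)) C∈)))
      where
      S = ∑ᵣ size·lam (clusters 𝒞)

      S≤Q : S ≤ᵣ Q G lam 𝒞
      -- The bound agrees with that of the singletons, which attain it, and a maximizer does at
      -- least as well.
      S≤Q = ≤ᵣ-trans S (∑ᵣ size·lam (clusters (singletons n))) (Q G lam 𝒞)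
        (∑size·lam≤∑size·lam 𝒞 (singletons n))
        (≤ᵣ-trans (∑ᵣ size·lam (clusters (singletons n))) (Q G lam (singletons n)) (Q G lam 𝒞)
          ∑size·lam≤Qsingletons (max (singletons n)))

-- Existence and uniqueness in both cases

∃-edge : ∀ {n} (G : Graph n) → Connected G → 3 ≤ n → ∃[ u ] ∃[ v ] Graph._~_ G u v
∃-edge G connected (s≤s (s≤s _)) with connected zero (suc zero)
-- The two endpoints differ, so the path between them cannot be empty.
... | u~v ◅ _ = _ , _ , u~v

lemma2 : ∀ {n : ℕ} (G : Graph n) → Connected G → 3 ≤ n →
    (∀ (lam : ℝ) → lam ≤ᵣ -1ᵣ →
    ∃! _≋_ (Maximizes G lam) ×
    (∀ (𝒞 : Clustering n) → Maximizes G lam 𝒞 → clusters 𝒞 ≡ [ ⊤ ]))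
    ×
    (∀ (lam : ℝ) → 1ᵣ ≤ᵣ lam →
    ∃! _≋_ (Maximizes G lam) ×
    (∀ (𝒞 : Clustering n) → Maximizes G lam 𝒞 →
    All (λ C → ∣ C ∣ ≡ 1) (clusters 𝒞)))
lemma2 {n} G connected 3≤n =
  (λ lam lam≤-1 →
    let u , v , u~v = ∃-edge G connected 3≤n
        unique = maximizes⇒oneCluster G connected lam u~v lam≤-1
    in
    ( oneCluster u
    , oneCluster-maximizes G connected lam u~v lam≤-1
    -- Here the lists of clusters are even equal, which is stronger than `≋`.
    , λ {𝒞} max → subst ([ ⊤ ] ∼[ set ]_) (sym (unique 𝒞 max)) (mk⇔ id id))
    , unique)
  , λ lam 1≤lam →
    let unique = maximizes⇒allSingletons G connected lam 3≤n 1≤lam in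
    ( singletons n
    , singletons-maximizes G connected lam 3≤n 1≤lam
    , λ {𝒞} max → allSingletons⇒≋ 𝒞 (unique 𝒞 max))
    , unique
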